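{- Let $p$ be a prime and suppose $E\subset\mathbb{F}_p^2$ $k$-tiles $\mathbb{F}_p^2$ by some $A\subset\mathbb{F}_p^2$. Then either $|E|=k$ and $A=\mathbb{F}_p^2$, or $E=\mathbb{F}_p^2$ and $|A|=k$, or $|E|=sp$ for some integer $1\le s\le p-1$ such that $s$ divides $k$, and $E$ is the union of $s$ pairwise disjoint graphs, i.e., there are a basis $\{e_1,e_2\}$ of $\mathbb{F}_p^2$ and functions $f_1,\dots,f_s:\mathbb{F}_p\to\mathbb{F}_p$ with $E=\bigcup_{i=1}^s\{xe_1+f_i(x)e_2: x\in\mathbb{F}_p\}$, the union being disjoint.
   Context: $E$ $k$-tiles $\mathbb{F}_p^d$ by $A$ means $\sum_{a\in A}1_E(x-a)=k$ for every $x\in\mathbb{F}_p^d$, where $1_E$ is the indicator function of $E$ and $k\ge1$ is an integer. -}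

module Defs where

open import Data.Nat using (ℕ; zero; suc; _+_; _*_; _∸_; NonZero)
open import Data.Nat.DivMod using (_mod_)
open import Data.Fin using (Fin; toℕ)
open import Data.Bool using (Bool; true; false; if_then_else_)
open import Data.Product using (_×_; _,_; proj₁; proj₂)
open import Data.List using (List; map; allFin; cartesianProduct)
open import Data.Nat.ListAction using (sum)
open import Relation.Binary.PropositionalEquality using (_≡_)

F : ℕ → Set
F p = Fin p

module _ {p : ℕ} .{{_ : NonZero p}} where

  _+F_ : F p → F p → F p
  a +F b = (toℕ a + toℕ b) mod p

  _-F_ : F p → F p → F p
  a -F b = (toℕ a + (p ∸ toℕ b)) mod p

  _*F_ : F p → F p → F p
  a *F b = (toℕ a * toℕ b) mod p

  0F : F p
  0F = 0 mod p

  V : Set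
  V = F p × F p

  0V : V
  0V = 0F , 0F

  _+V_ : V → V → V
  (a , b) +V (c , d) = (a +F c) , (b +F d)

  _-V_ : V → V → V
  (a , b) -V (c , d) = (a -F c) , (b -F d)

  _·_ : F p → V → V
  t · (a , b) = (t *F a) , (t *F b)

  points : List V
  points = cartesianProduct (allFin p) (allFin p)

  -- subsets of F_p^2 are given by their indicator functions 1_E
  ind : (V → Bool) → V → ℕ
  ind E v = if E v then 1 else 0

  card : (V → Bool) → ℕ
  card E = sum (map (ind E) points)

  KTiles : (E : V → Bool) (k : ℕ) (A : V → Bool) → Set
  KTiles E k A = ∀ x → sum (map (λ a → ind A a * ind E (x -V a)) points) ≡ k

  -- {e₁ , e₂} is a basis of F_p^2 (two vectors in a 2-dim space: linear independence)
  IsBasis : V → V → Set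
  IsBasis e₁ e₂ = ∀ a b → (a · e₁) +V (b · e₂) ≡ 0V → (a ≡ 0F) × (b ≡ 0F)

{-# OPTIONS --safe #-}

-- Fix a direction and let a, e : F_p → ℕ count the points of A and E on the p parallel lines. The
-- tiling identity says that the cyclic convolution a ⋆ e is constant, and this forces a or e to be
-- constant (in Fourier terms: the p-th cyclotomic polynomial is irreducible). To see this, work
-- with functions F_p → ℤ modulo constants. As the sum of a ⋆ e is divisible by p, so is the sum of
-- one factor, which is then Δh + const for the difference operator Δ; as Δ is injective modulo
-- constants, h may replace that factor. After p rounds one factor is Δ^p h + const, and
-- Δ^p ≡ 0 mod p by Newton's formula for h(t + p), so this factor may be divided by p: infinite
-- descent.
--
-- If E is equidistributed in some direction, with s points per line, then E is a union of s graphs,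
-- and s |A| = p k settles s = p and gives s ∣ k for s < p. Otherwise A is equidistributed in all
-- p + 1 directions, and counting A along the lines through a point v shows that 1_A(v) does not
-- depend on v.
module Submission where

open import Defs
open import Algebra.Bundles using (AbelianGroup; CommutativeSemigroup)
import Algebra.Properties.CommutativeSemigroup as CommutativeSemigroupProperties
import Algebra.Properties.Group as GroupProperties
import Algebra.Properties.Semiring.Sum as SemiringSum
open import Data.Bool using (Bool; true; false; if_then_else_)
open import Data.Fin using (Fin; toℕ; zero; suc)
open import Data.Fin.Permutation using (Permutation; permutation)
import Data.Fin.Properties as Fin
open import Data.Integer as ℤ using (ℤ; +_; ∣_∣)
import Data.Integer.Divisibility.Signed as ℤ
import Data.Integer.Properties as ℤ
open import Data.Integer.Tactic.RingSolver using (solve-∀)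
open import Data.List using (map; tabulate; cartesianProduct; _++_)
open import Data.List.Properties using (map-++; map-∘)
open import Data.Nat as ℕ using (ℕ; zero; suc; NonZero)
open import Data.Nat.Combinatorics using (_C_; nCk+nC[k+1]≡[n+1]C[k+1]; nCn≡1; nC1≡n)
import Data.Nat.Coprimality as Coprimality
open import Data.Nat.DivMod
import Data.Nat.Divisibility as ℕ
import Data.Nat.GCD as GCD
open import Data.Nat.ListAction using () renaming (sum to sumList)
open import Data.Nat.ListAction.Properties using (sum-++)
open import Data.Nat.Primality using (Prime; euclidsLemma; prime⇒nonTrivial)
import Data.Nat.Properties as ℕ
import Data.Nat.Tactic.RingSolver as ℕSolver
open import Data.Product using (_×_; Σ; ∃; ∃₂; _,_; proj₁; proj₂)
open import Data.Sum as Sum using (_⊎_; inj₁; inj₂; [_,_]′)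
open import Function.Base using (_∘_)
open import Function.Bundles using (_⇔_; mk⇔)
open import Relation.Binary.PropositionalEquality
open import Relation.Binary.PropositionalEquality.Algebra using (isMagma)
open import Relation.Nullary using (Dec; yes; no; contradiction)
open import Relation.Nullary.Decidable using (decidable-stable)

module ℤGroup = GroupProperties (AbelianGroup.group ℤ.+-0-abelianGroup)
module Σℕ = SemiringSum ℕ.+-*-semiring
module Σℤ = SemiringSum ℤ.+-*-semiring

-- Arithmetic in F_p

module _ {p : ℕ} .{{_ : NonZero p}} where

  1F : F p
  1F = 1 mod p

  toℕ-mod : ∀ n → toℕ (n mod p) ≡ n % p
  toℕ-mod n = Fin.toℕ-fromℕ< (m%n<n n p)

  mod-cong : ∀ {m n} → m % p ≡ n % p → m mod p ≡ n mod p
  mod-cong {m} {n} eq = Fin.fromℕ<-cong (m % p) (n % p) eq (m%n<n m p) (m%n<n n p)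

  toℕ-mod-inverse : (x : F p) → toℕ x mod p ≡ x
  toℕ-mod-inverse x = Fin.toℕ-injective
    (trans (toℕ-mod (toℕ x)) (m<n⇒m%n≡m (Fin.toℕ<n x)))

  -- Every element is the residue of a natural number, so with `+F-mod` and `*F-mod` ring laws of
  -- F_p reduce to those of ℕ.
  mod-elim : ∀ {ℓ} (P : F p → Set ℓ) → (∀ n → P (n mod p)) → ∀ x → P x
  mod-elim P h x = subst P (toℕ-mod-inverse x) (h (toℕ x))

  +F-mod : ∀ m n → (m mod p) +F (n mod p) ≡ (m ℕ.+ n) mod p
  +F-mod m n = mod-cong (trans
    (cong₂ (λ a b → (a ℕ.+ b) % p) (toℕ-mod m) (toℕ-mod n))
    (sym (%-distribˡ-+ m n p)))

  *F-mod : ∀ m n → (m mod p) *F (n mod p) ≡ (m ℕ.* n) mod p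
  *F-mod m n = mod-cong (trans
    (cong₂ (λ a b → (a ℕ.* b) % p) (toℕ-mod m) (toℕ-mod n))
    (sym (%-distribˡ-* m n p)))

  +F-comm : (x y : F p) → x +F y ≡ y +F x
  +F-comm x y = cong (_mod p) (ℕ.+-comm (toℕ x) (toℕ y))

  *F-comm : (x y : F p) → x *F y ≡ y *F x
  *F-comm x y = cong (_mod p) (ℕ.*-comm (toℕ x) (toℕ y))

  +F-assoc : (x y z : F p) → (x +F y) +F z ≡ x +F (y +F z)
  +F-assoc = mod-elim _ λ l → mod-elim _ λ m → mod-elim _ λ n → begin
    ((l mod p) +F (m mod p)) +F (n mod p) ≡⟨ cong (_+F (n mod p)) (+F-mod l m) ⟩
    ((l ℕ.+ m) mod p) +F (n mod p)        ≡⟨ +F-mod (l ℕ.+ m) n ⟩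
    (l ℕ.+ m ℕ.+ n) mod p                 ≡⟨ cong (_mod p) (ℕ.+-assoc l m n) ⟩
    (l ℕ.+ (m ℕ.+ n)) mod p               ≡⟨ +F-mod l (m ℕ.+ n) ⟨
    (l mod p) +F ((m ℕ.+ n) mod p)        ≡⟨ cong ((l mod p) +F_) (+F-mod m n) ⟨
    (l mod p) +F ((m mod p) +F (n mod p)) ∎
    where open ≡-Reasoning

  *F-assoc : (x y z : F p) → (x *F y) *F z ≡ x *F (y *F z)
  *F-assoc = mod-elim _ λ l → mod-elim _ λ m → mod-elim _ λ n → begin
    ((l mod p) *F (m mod p)) *F (n mod p) ≡⟨ cong (_*F (n mod p)) (*F-mod l m) ⟩
    ((l ℕ.* m) mod p) *F (n mod p)        ≡⟨ *F-mod (l ℕ.* m) n ⟩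
    (l ℕ.* m ℕ.* n) mod p                 ≡⟨ cong (_mod p) (ℕ.*-assoc l m n) ⟩
    (l ℕ.* (m ℕ.* n)) mod p               ≡⟨ *F-mod l (m ℕ.* n) ⟨
    (l mod p) *F ((m ℕ.* n) mod p)        ≡⟨ cong ((l mod p) *F_) (*F-mod m n) ⟨
    (l mod p) *F ((m mod p) *F (n mod p)) ∎
    where open ≡-Reasoning

  *F-distribʳ-+F : (x y z : F p) → (y +F z) *F x ≡ (y *F x) +F (z *F x)
  *F-distribʳ-+F = mod-elim _ λ l → mod-elim _ λ m → mod-elim _ λ n → begin
    ((m mod p) +F (n mod p)) *F (l mod p)        ≡⟨ cong (_*F (l mod p)) (+F-mod m n) ⟩
    ((m ℕ.+ n) mod p) *F (l mod p)               ≡⟨ *F-mod (m ℕ.+ n) l ⟩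
    ((m ℕ.+ n) ℕ.* l) mod p                      ≡⟨ cong (_mod p) (ℕ.*-distribʳ-+ l m n) ⟩
    (m ℕ.* l ℕ.+ n ℕ.* l) mod p                  ≡⟨ +F-mod (m ℕ.* l) (n ℕ.* l) ⟨
    ((m ℕ.* l) mod p) +F ((n ℕ.* l) mod p)       ≡⟨ cong₂ _+F_ (*F-mod m l) (*F-mod n l) ⟨
    ((m mod p) *F (l mod p)) +F ((n mod p) *F (l mod p)) ∎
    where open ≡-Reasoning

  +F-identityʳ : (x : F p) → x +F 0F ≡ x
  +F-identityʳ = mod-elim _ λ n → trans (+F-mod n 0) (cong (_mod p) (ℕ.+-identityʳ n))

  +F-identityˡ : (x : F p) → 0F +F x ≡ x
  +F-identityˡ x = trans (+F-comm 0F x) (+F-identityʳ x)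

  *F-identityʳ : (x : F p) → x *F 1F ≡ x
  *F-identityʳ = mod-elim _ λ n → trans (*F-mod n 1) (cong (_mod p) (ℕ.*-identityʳ n))

  *F-identityˡ : (x : F p) → 1F *F x ≡ x
  *F-identityˡ x = trans (*F-comm 1F x) (*F-identityʳ x)

  *F-zeroʳ : (x : F p) → x *F 0F ≡ 0F
  *F-zeroʳ = mod-elim _ λ n → trans (*F-mod n 0) (cong (_mod p) (ℕ.*-zeroʳ n))

  *F-zeroˡ : (x : F p) → 0F *F x ≡ 0F
  *F-zeroˡ x = trans (*F-comm 0F x) (*F-zeroʳ x)

  p-mod≡0F : p mod p ≡ 0F
  p-mod≡0F = mod-cong (trans (n%n≡0 p) (sym (m<n⇒m%n≡m (ℕ.>-nonZero⁻¹ p))))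

  -F-+F : (x y : F p) → (x -F y) +F y ≡ x
  -F-+F x y = begin
    (x -F y) +F y                               ≡⟨ cong ((x -F y) +F_) (toℕ-mod-inverse y) ⟨
    (x -F y) +F (toℕ y mod p)                   ≡⟨ +F-mod (toℕ x ℕ.+ (p ℕ.∸ toℕ y)) (toℕ y) ⟩
    (toℕ x ℕ.+ (p ℕ.∸ toℕ y) ℕ.+ toℕ y) mod p   ≡⟨ cong (_mod p) (ℕ.+-assoc (toℕ x) _ _) ⟩
    (toℕ x ℕ.+ (p ℕ.∸ toℕ y ℕ.+ toℕ y)) mod p   ≡⟨ cong (λ n → (toℕ x ℕ.+ n) mod p) (ℕ.m∸n+n≡m (Fin.toℕ≤n y)) ⟩
    (toℕ x ℕ.+ p) mod p                         ≡⟨ mod-cong ([m+n]%n≡m%n (toℕ x) p) ⟩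
    toℕ x mod p                                 ≡⟨ toℕ-mod-inverse x ⟩
    x                                           ∎
    where open ≡-Reasoning

  -- Through cancellation, `-F-+F` becomes the only fact needed about subtraction: the laws below
  -- add the subtrahend to both sides and cancel it.
  +F-cancelʳ : (z x y : F p) → x +F z ≡ y +F z → x ≡ y
  +F-cancelʳ z x y eq = begin
    x                     ≡⟨ undo x ⟨
    (x +F z) +F (0F -F z) ≡⟨ cong (_+F (0F -F z)) eq ⟩
    (y +F z) +F (0F -F z) ≡⟨ undo y ⟩
    y                     ∎
    where
    open ≡-Reasoning
    undo : ∀ w → (w +F z) +F (0F -F z) ≡ w
    undo w = begin
      (w +F z) +F (0F -F z) ≡⟨ +F-assoc w z _ ⟩
      w +F (z +F (0F -F z)) ≡⟨ cong (w +F_) (trans (+F-comm z _) (-F-+F 0F z)) ⟩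
      w +F 0F               ≡⟨ +F-identityʳ w ⟩
      w                     ∎

  +F-commutativeSemigroup : CommutativeSemigroup _ _
  +F-commutativeSemigroup = record
    { Carrier = F p
    ; _≈_ = _≡_
    ; _∙_ = _+F_
    ; isCommutativeSemigroup = record
      { isSemigroup = record
        { isMagma = isMagma _+F_
        ; assoc = +F-assoc
        }
      ; comm = +F-comm
      }
    }

  module +F = CommutativeSemigroupProperties +F-commutativeSemigroup

  +F--F : (x y : F p) → (x +F y) -F y ≡ x
  +F--F x y = +F-cancelʳ y _ _ (-F-+F (x +F y) y)

  -F-involutive : (c x : F p) → c -F (c -F x) ≡ x
  -F-involutive c x = +F-cancelʳ (c -F x) _ _
    (trans (-F-+F c _) (sym (trans (+F-comm x _) (-F-+F c x))))

  +F--F-comm : (x y z : F p) → (x +F y) -F z ≡ (x -F z) +F y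
  +F--F-comm x y z = +F-cancelʳ z _ _ (trans (-F-+F (x +F y) z)
    (sym (trans (+F.xy∙z≈xz∙y (x -F z) y z) (cong (_+F y) (-F-+F x z)))))

  +F--F-interchange : (w x y z : F p) → (w +F x) -F (y +F z) ≡ (w -F y) +F (x -F z)
  +F--F-interchange w x y z = +F-cancelʳ (y +F z) _ _ (trans (-F-+F (w +F x) (y +F z))
    (sym (trans (+F.interchange (w -F y) (x -F z) y z) (cong₂ _+F_ (-F-+F w y) (-F-+F x z)))))

  *F-distribʳ--F : (x y z : F p) → (y -F z) *F x ≡ (y *F x) -F (z *F x)
  *F-distribʳ--F x y z = +F-cancelʳ (z *F x) _ _ (trans (sym (*F-distribʳ-+F x (y -F z) z))
    (trans (cong (_*F x) (-F-+F y z)) (sym (-F-+F (y *F x) (z *F x)))))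

  -- A Bézout coefficient of toℕ s is an inverse of s up to sign.
  *F-inverse : Prime p → (s : F p) → s ≢ 0F → ∃ λ w → w *F s ≡ 1F
  *F-inverse pp s s≢0 = invert (Coprimality.coprime-Bézout (Coprimality.prime⇒coprime pp (Fin.toℕ<n s)))
    where
    open ≡-Reasoning
    instance
      s-nonZero : NonZero (toℕ s)
      s-nonZero = ℕ.≢-nonZero λ eq → s≢0 (trans (sym (toℕ-mod-inverse s)) (cong (_mod p) eq))
    mult : ∀ y → (y mod p) *F s ≡ (y ℕ.* toℕ s) mod p
    mult y = trans (cong ((y mod p) *F_) (sym (toℕ-mod-inverse s))) (*F-mod y (toℕ s))
    multiple : ∀ x → (x ℕ.* p) mod p ≡ 0F
    multiple x = mod-cong (trans (m*n%n≡0 x p) (sym (m<n⇒m%n≡m (ℕ.>-nonZero⁻¹ p))))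
    invert : GCD.Bézout.Identity 1 p (toℕ s) → ∃ λ w → w *F s ≡ 1F
    invert (GCD.Bézout.+- x y eq) = 0F -F (y mod p) , +F-cancelʳ ((y mod p) *F s) _ _ (begin
      ((0F -F (y mod p)) *F s) +F ((y mod p) *F s) ≡⟨ *F-distribʳ-+F s (0F -F (y mod p)) (y mod p) ⟨
      ((0F -F (y mod p)) +F (y mod p)) *F s        ≡⟨ cong (_*F s) (-F-+F 0F _) ⟩
      0F *F s                                      ≡⟨ *F-zeroˡ s ⟩
      0F                                           ≡⟨ multiple x ⟨
      (x ℕ.* p) mod p                              ≡⟨ cong (_mod p) eq ⟨
      (1 ℕ.+ y ℕ.* toℕ s) mod p                    ≡⟨ +F-mod 1 (y ℕ.* toℕ s) ⟨
      1F +F ((y ℕ.* toℕ s) mod p)                  ≡⟨ cong (1F +F_) (mult y) ⟨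
      1F +F ((y mod p) *F s)                       ∎)
    invert (GCD.Bézout.-+ x y eq) = y mod p , (begin
      (y mod p) *F s              ≡⟨ mult y ⟩
      (y ℕ.* toℕ s) mod p         ≡⟨ cong (_mod p) eq ⟨
      (1 ℕ.+ x ℕ.* p) mod p       ≡⟨ +F-mod 1 (x ℕ.* p) ⟨
      1F +F ((x ℕ.* p) mod p)     ≡⟨ cong (1F +F_) (multiple x) ⟩
      1F +F 0F                    ≡⟨ +F-identityʳ 1F ⟩
      1F                          ∎)

  translation : F p → Permutation p p
  translation c = permutation (_+F c) (_-F c) (λ x → -F-+F x c) (λ x → +F--F x c)

  translation⁻¹ : F p → Permutation p p
  translation⁻¹ c = permutation (_-F c) (_+F c) (λ x → +F--F x c) (λ x → -F-+F x c)

  reflection : F p → Permutation p p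
  reflection c = permutation (c -F_) (c -F_) (-F-involutive c) (-F-involutive c)

  scaling : (s w : F p) → w *F s ≡ 1F → Permutation p p
  scaling s w ws≡1 = permutation (s *F_) (w *F_)
    (λ x → undo s w x (trans (*F-comm s w) ws≡1)) (λ x → undo w s x ws≡1)
    where
    undo : ∀ u v x → u *F v ≡ 1F → u *F (v *F x) ≡ x
    undo u v x uv≡1 = trans (sym (*F-assoc u v x)) (trans (cong (_*F x) uv≡1) (*F-identityˡ x))

  F-induction : ∀ {ℓ} (P : F p → Set ℓ) → P 0F → (∀ t → P t → P (t +F 1F)) → ∀ t → P t
  F-induction P base step = mod-elim P go
    where
    go : ∀ n → P (n mod p)
    go zero    = base
    go (suc n) = subst P (trans (+F-mod n 1) (cong (_mod p) (ℕ.+-comm n 1))) (step _ (go n))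

-- Binomial coefficients divisible by p

[k+1]*[n+1]C[k+1]≡[n+1]*nCk : ∀ n k → suc k ℕ.* (suc n C suc k) ≡ suc n ℕ.* (n C k)
[k+1]*[n+1]C[k+1]≡[n+1]*nCk n zero = begin
  1 ℕ.* (suc n C 1)    ≡⟨ ℕ.*-identityˡ _ ⟩
  suc n C 1            ≡⟨ nC1≡n (suc n) ⟩
  suc n                ≡⟨ ℕ.*-identityʳ _ ⟨
  suc n ℕ.* 1          ∎
  where open ≡-Reasoning
[k+1]*[n+1]C[k+1]≡[n+1]*nCk zero (suc k) = ℕ.*-zeroʳ (suc (suc k))
-- Pascal's rule splits the left side, one copy of `x` is set aside, induction on `n` treats the two
-- remaining products, and Pascal's rule reassembles them into a multiple of `x`.
[k+1]*[n+1]C[k+1]≡[n+1]*nCk (suc n) (suc k) = begin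
  suc (suc k) ℕ.* (suc (suc n) C suc (suc k))
    ≡⟨ cong (suc (suc k) ℕ.*_) (nCk+nC[k+1]≡[n+1]C[k+1] (suc n) (suc k)) ⟨
  suc (suc k) ℕ.* (x ℕ.+ y)
    ≡⟨ regroup k x y ⟩
  x ℕ.+ (suc k ℕ.* x ℕ.+ suc (suc k) ℕ.* y)
    ≡⟨ cong₂ (λ a b → x ℕ.+ (a ℕ.+ b)) ([k+1]*[n+1]C[k+1]≡[n+1]*nCk n k) ([k+1]*[n+1]C[k+1]≡[n+1]*nCk n (suc k)) ⟩
  x ℕ.+ (suc n ℕ.* (n C k) ℕ.+ suc n ℕ.* (n C suc k))
    ≡⟨ cong (x ℕ.+_) (ℕ.*-distribˡ-+ (suc n) (n C k) (n C suc k)) ⟨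
  x ℕ.+ suc n ℕ.* (n C k ℕ.+ n C suc k)
    ≡⟨ cong (λ a → x ℕ.+ suc n ℕ.* a) (nCk+nC[k+1]≡[n+1]C[k+1] n k) ⟩
  suc (suc n) ℕ.* x ∎
  where
  open ≡-Reasoning
  x = suc n C suc k
  y = suc n C suc (suc k)
  regroup : ∀ k x y → suc (suc k) ℕ.* (x ℕ.+ y) ≡ x ℕ.+ (suc k ℕ.* x ℕ.+ suc (suc k) ℕ.* y)
  regroup = ℕSolver.solve-∀

-- By the absorption identity p divides k times the coefficient, and it cannot divide k, which lies
-- strictly between 0 and p.
prime∣pCk : ∀ {p} → Prime p → ∀ k → 0 ℕ.< k → k ℕ.< p → p ℕ.∣ (p C k)
prime∣pCk {suc n} pp (suc k) _ k<p
  with euclidsLemma (suc k) (suc n C suc k) pp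
         (ℕ.divides (n C k) (trans ([k+1]*[n+1]C[k+1]≡[n+1]*nCk n k) (ℕ.*-comm (suc n) (n C k))))
... | inj₁ p∣k = contradiction (ℕ.∣⇒≤ p∣k) (ℕ.<⇒≱ k<p)
... | inj₂ p∣C = p∣C

-- Cyclic convolution of integer-valued functions

module CyclicConvolution where

  open import Data.Integer using (_+_; _*_; _-_; -_)
  open import Data.Integer.Divisibility.Signed using (_∣_; divides)

  ∣-sum : ∀ {d n} (f : Fin n → ℤ) → (∀ i → d ∣ f i) → d ∣ Σℤ.sum f
  ∣-sum {n = zero}  f d∣f = divides (+ 0) refl
  ∣-sum {n = suc n} f d∣f = ℤ.∣m∣n⇒∣m+n (d∣f zero) (∣-sum (f ∘ suc) (d∣f ∘ suc))

  sum-const : ∀ n c → Σℤ.sum {n} (λ _ → c) ≡ + n * c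
  sum-const zero    c = refl
  sum-const (suc n) c = trans (cong (_+_ c) (sum-const n c)) (sym (ℤ.suc-* (+ n) c))

  sum-neg : ∀ {n} (f : Fin n → ℤ) → Σℤ.sum (λ i → - f i) ≡ - Σℤ.sum f
  sum-neg {zero}  f = refl
  sum-neg {suc n} f = trans (cong (_+_ (- f zero)) (sum-neg (f ∘ suc))) (sym (ℤ.neg-distrib-+ (f zero) _))

  sum-sub : ∀ {n} (f g : Fin n → ℤ) → Σℤ.sum (λ i → f i - g i) ≡ Σℤ.sum f - Σℤ.sum g
  sum-sub f g = trans (Σℤ.∑-distrib-+ f (-_ ∘ g)) (cong (_+_ (Σℤ.sum f)) (sum-neg g))

  sum-toℕ-suc : ∀ n (f : ℕ → ℤ) → Σℤ.sum {suc n} (f ∘ toℕ) ≡ Σℤ.sum {n} (f ∘ toℕ) + f n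
  sum-toℕ-suc n f = trans (Σℤ.sum-init-last {n} (f ∘ toℕ))
    (cong₂ _+_ (Σℤ.sum-cong-≗ {n} (cong f ∘ Fin.toℕ-inject₁)) (cong f (Fin.toℕ-fromℕ n)))

  -- Meant for Newton's formula, whose term of index 0 is the function value itself and need not be
  -- divisible.
  ∣-sum-tail : ∀ {d} n .{{_ : NonZero n}} (f : ℕ → ℤ) → (∀ k → 0 ℕ.< k → k ℕ.< n → d ∣ f k) →
               d ∣ Σℤ.sum {n} (f ∘ toℕ) - f 0
  ∣-sum-tail {d} (suc n) f d∣f = subst (d ∣_) (cancel (f 0) _)
    (∣-sum (λ (i : Fin n) → f (suc (toℕ i))) (λ i → d∣f (suc (toℕ i)) (ℕ.s≤s ℕ.z≤n) (ℕ.s≤s (Fin.toℕ<n i))))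
    where
    cancel : ∀ x y → y ≡ (x + y) - x
    cancel = solve-∀

  module _ {p : ℕ} .{{_ : NonZero p}} where

    -- The difference operator modulo constants

    Constant : (F p → ℤ) → Set
    Constant f = ∀ t → f t ≡ f 0F

    Δ : (F p → ℤ) → F p → ℤ
    Δ f t = f (t +F 1F) - f t

    Δ^ : ℕ → (F p → ℤ) → F p → ℤ
    Δ^ zero    f = f
    Δ^ (suc n) f = Δ (Δ^ n f)

    sum-Δ : ∀ f → Σℤ.sum (Δ f) ≡ + 0
    sum-Δ f = trans (sum-sub (λ t → f (t +F 1F)) f)
      (trans (cong (_- Σℤ.sum f) (sym (Σℤ.sum-permute f (translation 1F)))) (ℤ.+-inverseʳ (Σℤ.sum f)))

    -- The sum of `Δ f` over the cycle vanishes, so p times its constant value is 0 in ℤ. Hence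
    -- `Δ f` is 0, and `f` does not change from `t` to `t +F 1F`.
    Δ-constant⇒constant : ∀ f → Constant (Δ f) → Constant f
    Δ-constant⇒constant f const = F-induction (λ t → f t ≡ f 0F) refl
      (λ t eq → trans (ℤ.i-j≡0⇒i≡j (f (t +F 1F)) (f t) (trans (const t) Δf0≡0)) eq)
      where
      pΔf0≡0 : + p * Δ f 0F ≡ + 0
      pΔf0≡0 = trans (sym (sum-const p (Δ f 0F))) (trans (sym (Σℤ.sum-cong-≗ const)) (sum-Δ f))
      Δf0≡0 : Δ f 0F ≡ + 0
      Δf0≡0 with ℤ.i*j≡0⇒i≡0∨j≡0 (+ p) pΔf0≡0
      ... | inj₁ p≡0 = contradiction (ℤ.+-injective p≡0) (ℕ.≢-nonZero⁻¹ p)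
      ... | inj₂ eq  = eq

    Δ-antiderivative : ∀ g → Σℤ.sum g ≡ + 0 → ∃ λ h → ∀ t → Δ h t ≡ g t
    Δ-antiderivative g Σg≡0 = (λ t → H (toℕ t)) , Δh
      where
      open ≡-Reasoning
      -- Partial sums of `g` over 0, ..., n - 1. The vanishing total gives `H p ≡ H 0`, which lets
      -- `H` live on the cycle.
      H : ℕ → ℤ
      H n = Σℤ.sum {n} (λ i → g (toℕ i mod p))
      H-p : H p ≡ + 0
      H-p = trans (Σℤ.sum-cong-≗ (λ i → cong g (toℕ-mod-inverse i))) Σg≡0
      -- The case `n ≡ p` is the wrap-around from p - 1 back to 0.
      H-% : ∀ n → n ℕ.≤ p → H (n % p) ≡ H n
      H-% n n≤p with ℕ.m≤n⇒m<n∨m≡n n≤p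
      ... | inj₁ n<p  = cong H (m<n⇒m%n≡m n<p)
      ... | inj₂ refl = trans (cong H (n%n≡0 p)) (sym H-p)
      cancel : ∀ x y → (x + y) - x ≡ y
      cancel = solve-∀
      toℕ-suc : ∀ t → toℕ (t +F 1F) ≡ suc (toℕ t) % p
      toℕ-suc t = begin
        toℕ (t +F 1F)                   ≡⟨ cong (λ u → toℕ (u +F 1F)) (toℕ-mod-inverse t) ⟨
        toℕ ((toℕ t mod p) +F 1F)       ≡⟨ cong toℕ (+F-mod (toℕ t) 1) ⟩
        toℕ ((toℕ t ℕ.+ 1) mod p)       ≡⟨ toℕ-mod (toℕ t ℕ.+ 1) ⟩
        (toℕ t ℕ.+ 1) % p               ≡⟨ cong (_% p) (ℕ.+-comm (toℕ t) 1) ⟩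
        suc (toℕ t) % p                 ∎
      Δh : ∀ t → H (toℕ (t +F 1F)) - H (toℕ t) ≡ g t
      Δh t = begin
        H (toℕ (t +F 1F)) - H (toℕ t)              ≡⟨ cong (λ n → H n - H (toℕ t)) (toℕ-suc t) ⟩
        H (suc (toℕ t) % p) - H (toℕ t)            ≡⟨ cong (_- H (toℕ t)) (H-% (suc (toℕ t)) (Fin.toℕ<n t)) ⟩
        H (suc (toℕ t)) - H (toℕ t)                ≡⟨ cong (_- H (toℕ t)) (sum-toℕ-suc (toℕ t) (λ n → g (n mod p))) ⟩
        (H (toℕ t) + g (toℕ t mod p)) - H (toℕ t)  ≡⟨ cancel (H (toℕ t)) _ ⟩
        g (toℕ t mod p)                            ≡⟨ cong g (toℕ-mod-inverse t) ⟩
        g t                                        ∎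

    -- The mean `c` of `f` is an integer by divisibility; subtracting it leaves a function of sum 0,
    -- which has an antiderivative.
    ∣sum⇒Δ+constant : ∀ f → + p ∣ Σℤ.sum f → ∃₂ λ h c → ∀ t → f t ≡ Δ h t + c
    ∣sum⇒Δ+constant f (divides c Σf≡cp) =
      let h , Δh≡g = Δ-antiderivative (λ t → f t - c) Σg≡0 in
      h , c , λ t → trans (restore (f t) c) (cong (_+ c) (sym (Δh≡g t)))
      where
      open ≡-Reasoning
      restore : ∀ x c → x ≡ (x - c) + c
      restore = solve-∀
      Σg≡0 : Σℤ.sum (λ t → f t - c) ≡ + 0
      Σg≡0 = begin
        Σℤ.sum (λ t → f t - c)               ≡⟨ sum-sub f (λ _ → c) ⟩
        Σℤ.sum f - Σℤ.sum {p} (λ _ → c)      ≡⟨ cong₂ _-_ Σf≡cp (sum-const p c) ⟩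
        c * + p - + p * c                    ≡⟨ cong (λ x → c * + p - x) (ℤ.*-comm (+ p) c) ⟩
        c * + p - c * + p                    ≡⟨ ℤ.+-inverseʳ (c * + p) ⟩
        + 0                                  ∎

    -- This is the binomial expansion of the n-th power of 1 + Δ. Any number `m` of terms above `n`
    -- is allowed, since the surplus coefficients vanish; the induction uses this freedom.
    newton : ∀ n m → n ℕ.< m → ∀ f t →
             f (t +F (n mod p)) ≡ Σℤ.sum {m} (λ k → + (n C toℕ k) * Δ^ (toℕ k) f t)
    newton zero (suc m) n<m f t = begin
      f (t +F 0F)                ≡⟨ cong f (+F-identityʳ t) ⟩
      f t                        ≡⟨ unit (f t) ⟩
      + 1 * f t + + 0            ≡⟨ cong (_+_ (+ 1 * f t)) (Σℤ.sum-replicate-zero m) ⟨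
      + 1 * f t + Σℤ.sum {m} (λ _ → + 0) ∎
      where
      open ≡-Reasoning
      unit : ∀ x → x ≡ + 1 * x + + 0
      unit = solve-∀
    newton (suc n) (suc m) (ℕ.s≤s n<m) f t = begin
      f (t +F (suc n mod p))                                     ≡⟨ cong f shift ⟩
      f ((t +F 1F) +F (n mod p))                                 ≡⟨ newton n m n<m f (t +F 1F) ⟩
      Σℤ.sum {m} (λ k → B (toℕ k) * Δ^ (toℕ k) f (t +F 1F))      ≡⟨ Σℤ.sum-cong-≗ {m} (λ k → step (B (toℕ k)) (Δ^ (toℕ k) f (t +F 1F)) (D (toℕ k))) ⟩
      Σℤ.sum {m} (λ k → B (toℕ k) * D (toℕ k) + B (toℕ k) * D (suc (toℕ k)))
        ≡⟨ Σℤ.∑-distrib-+ {m} (λ k → B (toℕ k) * D (toℕ k)) (λ k → B (toℕ k) * D (suc (toℕ k))) ⟩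
      Σℤ.sum {m} (λ k → B (toℕ k) * D (toℕ k)) + R               ≡⟨ cong (_+ R) (newton n m n<m f t) ⟨
      -- The sum folded back into a function value is expanded again with one more, vanishing, term.
      -- Without its head it then has the same length as `R`, and Pascal's rule applies termwise.
      f (t +F (n mod p)) + R                                     ≡⟨ cong (_+ R) (newton n (suc m) (ℕ.m<n⇒m<1+n n<m) f t) ⟩
      (B 0 * D 0 + S) + R                                        ≡⟨ ℤ.+-assoc (B 0 * D 0) S R ⟩
      B 0 * D 0 + (S + R)                                        ≡⟨ cong (_+_ (B 0 * D 0)) (trans (ℤ.+-comm S R)
        (sym (Σℤ.∑-distrib-+ {m} (λ k → B (toℕ k) * D (suc (toℕ k))) (λ k → B (suc (toℕ k)) * D (suc (toℕ k)))))) ⟩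
      B 0 * D 0 + Σℤ.sum {m} (λ k → B (toℕ k) * D (suc (toℕ k)) + B (suc (toℕ k)) * D (suc (toℕ k)))
        ≡⟨ cong (_+_ (B 0 * D 0)) (Σℤ.sum-cong-≗ {m} (λ k → pascal (toℕ k))) ⟩
      B 0 * D 0 + Σℤ.sum {m} (λ k → + (suc n C suc (toℕ k)) * D (suc (toℕ k))) ∎
      where
      open ≡-Reasoning
      B : ℕ → ℤ
      B k = + (n C k)
      D : ℕ → ℤ
      D k = Δ^ k f t
      R = Σℤ.sum {m} (λ k → B (toℕ k) * D (suc (toℕ k)))
      S = Σℤ.sum {m} (λ k → B (suc (toℕ k)) * D (suc (toℕ k)))
      shift : t +F (suc n mod p) ≡ (t +F 1F) +F (n mod p)
      shift = trans (cong (t +F_) (sym (+F-mod 1 n))) (sym (+F-assoc t 1F (n mod p)))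
      step : ∀ b x y → b * x ≡ b * y + b * (x - y)
      step = solve-∀
      pascal : ∀ k → B k * D (suc k) + B (suc k) * D (suc k) ≡ + (suc n C suc k) * D (suc k)
      pascal k = trans (sym (ℤ.*-distribʳ-+ (D (suc k)) (B k) (B (suc k))))
        (cong (λ c → + c * D (suc k)) (nCk+nC[k+1]≡[n+1]C[k+1] n k))

    -- For a shift by p the left side of Newton's formula is `f t`, which cancels the term of index
    -- 0. The terms of index strictly between 0 and p are divisible by p, and the last one is
    -- `Δ^ p f t`.
    prime∣Δ^p : Prime p → ∀ f t → + p ∣ Δ^ p f t
    prime∣Δ^p pp f t = subst (+ p ∣_) Δ^p≡ (ℤ.∣m⇒∣-m (∣-sum-tail p T λ k 0<k k<p → ℤ.∣m⇒∣m*n {m = + (p C k)} (Δ^ k f t) (ℤ.∣ᵤ⇒∣ (prime∣pCk pp k 0<k k<p))))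
      where
      open ≡-Reasoning
      T : ℕ → ℤ
      T k = + (p C k) * Δ^ k f t
      total = Σℤ.sum {p} (T ∘ toℕ)
      cancel : ∀ s x y → s + y ≡ x → - (s - x) ≡ y
      cancel s x y refl = identity s y
        where
        identity : ∀ s y → - (s - (s + y)) ≡ y
        identity = solve-∀
      Δ^p≡ : - (total - T 0) ≡ Δ^ p f t
      Δ^p≡ = cancel total (T 0) (Δ^ p f t) (begin
        total + Δ^ p f t                 ≡⟨ cong (_+_ total) (ℤ.*-identityˡ (Δ^ p f t)) ⟨
        total + + 1 * Δ^ p f t           ≡⟨ cong (λ c → total + + c * Δ^ p f t) (nCn≡1 p) ⟨
        total + T p                      ≡⟨ sum-toℕ-suc p T ⟨
        Σℤ.sum {suc p} (T ∘ toℕ)     ≡⟨ newton p (suc p) (ℕ.n<1+n p) f t ⟨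
        f (t +F (p mod p))           ≡⟨ cong f (trans (cong (t +F_) p-mod≡0F) (+F-identityʳ t)) ⟩
        f t                          ≡⟨ ℤ.*-identityˡ (f t) ⟨
        T 0                          ∎)

    -- Convolution and its compatibility with Δ and affine maps

    infixl 7 _⋆_

    _⋆_ : (F p → ℤ) → (F p → ℤ) → F p → ℤ
    (e ⋆ a) t = Σℤ.sum (λ s → e s * a (t -F s))

    ⋆-comm : ∀ e a t → (e ⋆ a) t ≡ (a ⋆ e) t
    ⋆-comm e a t = trans (Σℤ.sum-permute (λ s → e s * a (t -F s)) (reflection t))
      (Σℤ.sum-cong-≗ λ s → trans (cong (λ u → e (t -F s) * a u) (-F-involutive t s)) (ℤ.*-comm (e (t -F s)) (a s)))

    sum-⋆ : ∀ e a → Σℤ.sum (e ⋆ a) ≡ Σℤ.sum e * Σℤ.sum a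
    sum-⋆ e a = begin
      Σℤ.sum (λ t → Σℤ.sum (λ s → e s * a (t -F s))) ≡⟨ Σℤ.∑-comm (λ t s → e s * a (t -F s)) ⟩
      Σℤ.sum (λ s → Σℤ.sum (λ t → e s * a (t -F s))) ≡⟨ Σℤ.sum-cong-≗ (λ s → Σℤ.*-distribˡ-sum (e s) (λ t → a (t -F s))) ⟨
      Σℤ.sum (λ s → e s * Σℤ.sum (λ t → a (t -F s))) ≡⟨ Σℤ.sum-cong-≗ (λ s → cong (_*_ (e s)) (Σℤ.sum-permute a (translation⁻¹ s))) ⟨
      Σℤ.sum (λ s → e s * Σℤ.sum a)                  ≡⟨ Σℤ.*-distribʳ-sum (Σℤ.sum a) e ⟨
      Σℤ.sum e * Σℤ.sum a                            ∎
      where open ≡-Reasoning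

    ⋆-affine : ∀ e {a b : F p → ℤ} {d c} → (∀ t → a t ≡ b t * d + c) →
               ∀ t → (e ⋆ a) t ≡ (e ⋆ b) t * d + Σℤ.sum e * c
    ⋆-affine e {a} {b} {d} {c} a≡bd+c t = begin
      Σℤ.sum (λ s → e s * a (t -F s))
        ≡⟨ Σℤ.sum-cong-≗ (λ s → trans (cong (_*_ (e s)) (a≡bd+c (t -F s))) (expand (e s) (b (t -F s)) d c)) ⟩
      Σℤ.sum (λ s → e s * b (t -F s) * d + e s * c)
        ≡⟨ Σℤ.∑-distrib-+ (λ s → e s * b (t -F s) * d) (λ s → e s * c) ⟩
      Σℤ.sum (λ s → e s * b (t -F s) * d) + Σℤ.sum (λ s → e s * c)
        ≡⟨ cong₂ _+_ (Σℤ.*-distribʳ-sum d (λ s → e s * b (t -F s))) (Σℤ.*-distribʳ-sum c e) ⟨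
      (e ⋆ b) t * d + Σℤ.sum e * c ∎
      where
      open ≡-Reasoning
      expand : ∀ e b d c → e * (b * d + c) ≡ e * b * d + e * c
      expand = solve-∀

    ⋆-Δ : ∀ e a t → (e ⋆ Δ a) t ≡ Δ (e ⋆ a) t
    ⋆-Δ e a t = begin
      Σℤ.sum (λ s → e s * (a ((t -F s) +F 1F) - a (t -F s)))
        ≡⟨ Σℤ.sum-cong-≗ (λ s → trans (cong (λ u → e s * (a u - a (t -F s))) (sym (+F--F-comm t 1F s)))
             (expand (e s) (a ((t +F 1F) -F s)) (a (t -F s)))) ⟩
      Σℤ.sum (λ s → e s * a ((t +F 1F) -F s) - e s * a (t -F s))
        ≡⟨ sum-sub (λ s → e s * a ((t +F 1F) -F s)) (λ s → e s * a (t -F s)) ⟩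
      Δ (e ⋆ a) t ∎
      where
      open ≡-Reasoning
      expand : ∀ e x y → e * (x - y) ≡ e * x - e * y
      expand = solve-∀

    ⋆-constant-sym : ∀ e a → Constant (e ⋆ a) → Constant (a ⋆ e)
    ⋆-constant-sym e a const t = trans (⋆-comm a e t) (trans (const t) (⋆-comm e a 0F))

    -- The summand `c` only adds the constant `Σℤ.sum e * c`, and `d` can be cancelled. The case
    -- `d = + 1` drops a constant, the case `d = + p` carries out a descent step.
    ⋆-constant-affine⁻ : ∀ e {a b d c} → d ≢ + 0 → (∀ t → a t ≡ b t * d + c) →
                         Constant (e ⋆ a) → Constant (e ⋆ b)
    ⋆-constant-affine⁻ e {a} {b} {d} {c} d≢0 a≡bd+c const t =
      ℤ.*-cancelʳ-≡ _ _ d (ℤGroup.∙-cancelʳ (Σℤ.sum e * c) _ _ (begin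
        (e ⋆ b) t * d + Σℤ.sum e * c   ≡⟨ ⋆-affine e {a} {b} {d} {c} a≡bd+c t ⟨
        (e ⋆ a) t                      ≡⟨ const t ⟩
        (e ⋆ a) 0F                     ≡⟨ ⋆-affine e {a} {b} {d} {c} a≡bd+c 0F ⟩
        (e ⋆ b) 0F * d + Σℤ.sum e * c  ∎))
      where
      open ≡-Reasoning
      instance
        d-nonZero : ℤ.NonZero d
        d-nonZero = ℤ.≢-nonZero d≢0

    -- Convolution commutes with Δ, and Δ is injective modulo constants.
    ⋆-constant-Δ⁻ : ∀ e {a h c} → (∀ t → a t ≡ Δ h t + c) → Constant (e ⋆ a) → Constant (e ⋆ h)
    ⋆-constant-Δ⁻ e {a} {h} {c} a≡Δh+c const = Δ-constant⇒constant (e ⋆ h) λ t →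
      trans (sym (⋆-Δ e h t)) (trans (flat t) (⋆-Δ e h 0F))
      where
      flat : Constant (e ⋆ Δ h)
      flat = ⋆-constant-affine⁻ e {a} {Δ h} {+ 1} {c} (λ ())
        (λ t → trans (a≡Δh+c t) (cong (_+ c) (sym (ℤ.*-identityʳ (Δ h t))))) const

    -- Infinite descent

    Δ^+constant : ℕ → (F p → ℤ) → Set
    Δ^+constant n f = ∃₂ λ h c → ∀ t → f t ≡ Δ^ n h t + c

    -- The constant `d` of the inner representation is killed by the outer difference.
    Δ^+constant-suc : ∀ n {f h c} → (∀ t → f t ≡ Δ h t + c) → Δ^+constant n h → Δ^+constant (suc n) f
    Δ^+constant-suc n {f} {h} {c} f≡Δh+c (g , d , h≡) = g , c , λ t → trans (f≡Δh+c t)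
      (cong (_+ c) (trans (cong₂ _-_ (h≡ (t +F 1F)) (h≡ t)) (cancel (Δ^ n g (t +F 1F)) (Δ^ n g t) d)))
      where
      cancel : ∀ x y d → (x + d) - (y + d) ≡ x - y
      cancel = solve-∀

    module _ (pp : Prime p) where

      -- Summing the constant convolution over F_p gives p times its value, and also the product of
      -- the two sums; Euclid's lemma applies.
      prime∣sum : ∀ e a → Constant (e ⋆ a) → (+ p ∣ Σℤ.sum e) ⊎ (+ p ∣ Σℤ.sum a)
      prime∣sum e a const = Sum.map ℤ.∣ᵤ⇒∣ ℤ.∣ᵤ⇒∣ (euclidsLemma ∣ Σℤ.sum e ∣ ∣ Σℤ.sum a ∣ pp
        (subst (p ℕ.∣_) (ℤ.abs-* (Σℤ.sum e) (Σℤ.sum a)) (ℤ.∣⇒∣ᵤ p∣σσ)))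
        where
        p∣σσ : + p ∣ Σℤ.sum e * Σℤ.sum a
        p∣σσ = divides ((e ⋆ a) 0F) (trans (sym (sum-⋆ e a)) (trans (Σℤ.sum-cong-≗ const)
          (trans (sum-const p ((e ⋆ a) 0F)) (ℤ.*-comm (+ p) _))))

      -- Here `m` and `n` are the antiderivatives still to be taken of `e` and `a`. Each round
      -- integrates one factor and lowers only its own number, so one of them reaches 0 after
      -- finitely many rounds.
      ⋆-constant⇒Δ^+constant : ∀ m n e a → Constant (e ⋆ a) → Δ^+constant m e ⊎ Δ^+constant n a
      ⋆-constant⇒Δ^+constant zero n e a const = inj₁ (e , + 0 , λ t → sym (ℤ.+-identityʳ (e t)))
      ⋆-constant⇒Δ^+constant (suc m) zero e a const = inj₂ (a , + 0 , λ t → sym (ℤ.+-identityʳ (a t)))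
      ⋆-constant⇒Δ^+constant (suc m) (suc n) e a const =
        [ (λ p∣σe → peelˡ (∣sum⇒Δ+constant e p∣σe)) , (λ p∣σa → peelʳ (∣sum⇒Δ+constant a p∣σa)) ]′
          (prime∣sum e a const)
        where
        peelˡ : (∃₂ λ h c → ∀ t → e t ≡ Δ h t + c) → Δ^+constant (suc m) e ⊎ Δ^+constant (suc n) a
        peelˡ (h , c , e≡) = Sum.map₁ (Δ^+constant-suc m {e} {h} {c} e≡)
          (⋆-constant⇒Δ^+constant m (suc n) h a
            (⋆-constant-sym a h (⋆-constant-Δ⁻ a {e} {h} {c} e≡ (⋆-constant-sym e a const))))
        peelʳ : (∃₂ λ h c → ∀ t → a t ≡ Δ h t + c) → Δ^+constant (suc m) e ⊎ Δ^+constant (suc n) a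
        peelʳ (h , c , a≡) = Sum.map₂ (Δ^+constant-suc n {a} {h} {c} a≡)
          (⋆-constant⇒Δ^+constant (suc m) n e h (⋆-constant-Δ⁻ e {a} {h} {c} a≡ const))

      Δ^p+constant⇒p-affine : ∀ f → Δ^+constant p f → ∃₂ λ g c → ∀ t → f t ≡ g t * + p + c
      Δ^p+constant⇒p-affine f (h , c , f≡) =
        (λ t → ℤ.quotient (d t)) , c , λ t → trans (f≡ t) (cong (_+ c) (ℤ._∣_.equality (d t)))
        where
        d : ∀ t → + p ∣ Δ^ p h t
        d = prime∣Δ^p pp h

      affine-diff : ∀ (f g : F p → ℤ) c → (∀ t → f t ≡ g t * + p + c) → ∀ t u →
                    ∣ f t - f u ∣ ≡ ∣ g t - g u ∣ ℕ.* p
      affine-diff f g c f≡ t u = trans (cong ∣_∣ (trans (cong₂ _-_ (f≡ t) (f≡ u)) (factor (g t) (g u) (+ p) c)))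
        (ℤ.abs-* (g t - g u) (+ p))
        where
        factor : ∀ x y p c → (x * p + c) - (y * p + c) ≡ (x - y) * p
        factor = solve-∀

      affine-≡ : ∀ (f g : F p → ℤ) c → (∀ t → f t ≡ g t * + p + c) → ∀ t u → g t ≡ g u → f t ≡ f u
      affine-≡ f g c f≡ t u eq = trans (f≡ t) (trans (cong (λ x → x * + p + c) eq) (sym (f≡ u)))

      -- The difference for `f` is p times that for `g` and is nonzero, so p > 1 makes the
      -- inequality strict.
      affine-< : ∀ (f g : F p → ℤ) c → (∀ t → f t ≡ g t * + p + c) → ∀ t u → f t ≢ f u →
                 ∣ g t - g u ∣ ℕ.< ∣ f t - f u ∣
      affine-< f g c f≡ t u ft≢fu = subst (∣ g t - g u ∣ ℕ.<_) (sym (affine-diff f g c f≡ t u))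
        (ℕ.m<m*n ∣ g t - g u ∣ p {{ℕ.≢-nonZero nz}} (ℕ.nonTrivial⇒n>1 p))
        where
        instance _ = prime⇒nonTrivial pp
        nz : ∣ g t - g u ∣ ≢ 0
        nz eq = ft≢fu (affine-≡ f g c f≡ t u (ℤ.i-j≡0⇒i≡j (g t) (g u) (ℤ.∣i∣≡0⇒i≡0 eq)))

      -- Descent on the sum of the two differences, for fixed pairs of arguments. If both are
      -- nonzero, one factor is affine in some `g` with scale p; replacing it by `g` keeps the
      -- convolution constant and shrinks the sum. An equality found for `g` lifts back by
      -- `affine-≡`.
      ⋆-constant⇒pointwise : ∀ N (e a : F p → ℤ) t u t′ u′ → ∣ e t - e u ∣ ℕ.+ ∣ a t′ - a u′ ∣ ℕ.≤ N →
                             Constant (e ⋆ a) → e t ≡ e u ⊎ a t′ ≡ a u′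
      ⋆-constant⇒pointwise zero e a t u t′ u′ bound const =
        inj₁ (ℤ.i-j≡0⇒i≡j (e t) (e u) (ℤ.∣i∣≡0⇒i≡0 (ℕ.m+n≡0⇒m≡0 _ (ℕ.n≤0⇒n≡0 bound))))
      ⋆-constant⇒pointwise (suc N) e a t u t′ u′ bound const = descend (e t ℤ.≟ e u) (a t′ ℤ.≟ a u′)
        where
        p≢0 : + p ≢ + 0
        p≢0 = ℕ.≢-nonZero⁻¹ p ∘ ℤ.+-injective
        descendˡ : e t ≢ e u → (∃₂ λ g c → ∀ t → e t ≡ g t * + p + c) → e t ≡ e u ⊎ a t′ ≡ a u′
        descendˡ e≢ (g , c , e≡) = Sum.map₁ (affine-≡ e g c e≡ t u) (⋆-constant⇒pointwise N g a t u t′ u′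
          (ℕ.s≤s⁻¹ (ℕ.≤-trans (ℕ.+-monoˡ-< ∣ a t′ - a u′ ∣ (affine-< e g c e≡ t u e≢)) bound))
          (⋆-constant-sym a g (⋆-constant-affine⁻ a {e} {g} {+ p} {c} p≢0 e≡ (⋆-constant-sym e a const))))
        descendʳ : a t′ ≢ a u′ → (∃₂ λ g c → ∀ t → a t ≡ g t * + p + c) → e t ≡ e u ⊎ a t′ ≡ a u′
        descendʳ a≢ (g , c , a≡) = Sum.map₂ (affine-≡ a g c a≡ t′ u′) (⋆-constant⇒pointwise N e g t u t′ u′
          (ℕ.s≤s⁻¹ (ℕ.≤-trans (ℕ.+-monoʳ-< ∣ e t - e u ∣ (affine-< a g c a≡ t′ u′ a≢)) bound))
          (⋆-constant-affine⁻ e {a} {g} {+ p} {c} p≢0 a≡ const))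
        descend : Dec (e t ≡ e u) → Dec (a t′ ≡ a u′) → e t ≡ e u ⊎ a t′ ≡ a u′
        descend (yes eq) _ = inj₁ eq
        descend (no _) (yes eq) = inj₂ eq
        descend (no e≢) (no a≢) =
          [ (λ q → descendˡ e≢ (Δ^p+constant⇒p-affine e q)) , (λ q → descendʳ a≢ (Δ^p+constant⇒p-affine a q)) ]′
            (⋆-constant⇒Δ^+constant p p e a const)

      -- Constancy of `e` is decidable on a finite domain. If it fails, a single `t′` with
      -- `a t′ ≢ a 0F` would, by the pointwise result, force `e t ≡ e 0F` for every `t`.
      ⋆-constant⇒constant : ∀ e a → Constant (e ⋆ a) → Constant e ⊎ Constant a
      ⋆-constant⇒constant e a const = decide (Fin.all? (λ t → e t ℤ.≟ e 0F))
        where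
        decide : Dec (Constant e) → Constant e ⊎ Constant a
        decide (yes e-const) = inj₁ e-const
        decide (no ¬e-const) = inj₂ λ t′ → decidable-stable (a t′ ℤ.≟ a 0F) λ a≢ → ¬e-const λ t →
          [ (λ eq → eq) , (λ eq → contradiction eq a≢) ]′
            (⋆-constant⇒pointwise _ e a t 0F t′ 0F ℕ.≤-refl const)

open CyclicConvolution
open import Data.Nat using (_+_; _*_; _∸_; _≤_; _<_; _≟_)
open import Data.Nat.Divisibility using (_∣_)

-- Sums and counting

sumList-map-tabulate : ∀ {X : Set} {n} (g : X → ℕ) (h : Fin n → X) →
                       sumList (map g (tabulate h)) ≡ Σℕ.sum (g ∘ h)
sumList-map-tabulate {n = zero}  g h = refl
sumList-map-tabulate {n = suc n} g h = cong (g (h zero) ℕ.+_) (sumList-map-tabulate g (h ∘ suc))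

sumList-cartesianProduct : ∀ {X Y : Set} {m} {n} (g : X × Y → ℕ) (h : Fin m → X) (l : Fin n → Y) →
  sumList (map g (cartesianProduct (tabulate h) (tabulate l)))
    ≡ Σℕ.sum (λ i → Σℕ.sum (λ j → g (h i , l j)))
sumList-cartesianProduct {m = zero}  g h l = refl
sumList-cartesianProduct {m = suc m} g h l = begin
  sumList (map g (map (h zero ,_) (tabulate l) ++ rest))
    ≡⟨ cong sumList (map-++ g (map (h zero ,_) (tabulate l)) rest) ⟩
  sumList (map g (map (h zero ,_) (tabulate l)) ++ map g rest)
    ≡⟨ sum-++ (map g (map (h zero ,_) (tabulate l))) (map g rest) ⟩
  sumList (map g (map (h zero ,_) (tabulate l))) + sumList (map g rest)
    ≡⟨ cong₂ ℕ._+_ (trans (cong sumList (sym (map-∘ (tabulate l)))) (sumList-map-tabulate (λ y → g (h zero , y)) l))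
         (sumList-cartesianProduct g (h ∘ suc) l) ⟩
  Σℕ.sum (λ i → Σℕ.sum (λ j → g (h i , l j))) ∎
  where
  open ≡-Reasoning
  rest = cartesianProduct (tabulate (h ∘ suc)) (tabulate l)

sumℕ-const : ∀ n c → Σℕ.sum {n} (λ _ → c) ≡ n * c
sumℕ-const zero    c = refl
sumℕ-const (suc n) c = cong (c ℕ.+_) (sumℕ-const n c)

pos-sum : ∀ {n} (f : Fin n → ℕ) → + Σℕ.sum f ≡ Σℤ.sum (λ i → + f i)
pos-sum {zero}  f = refl
pos-sum {suc n} f = trans (ℤ.pos-+ (f zero) _) (cong (ℤ._+_ (+ f zero)) (pos-sum (f ∘ suc)))

-- Adding `c` fills in the exceptional place and avoids the subtraction in n - 1.
sum-one-exception : ∀ {n} (x : Fin n) (h : Fin n → ℕ) c → (∀ s → s ≢ x → h s ≡ c) →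
                    Σℕ.sum h + c ≡ n * c + h x
sum-one-exception {suc n} zero h c h≡c = begin
  (h zero + Σℕ.sum (h ∘ suc)) + c ≡⟨ cong (λ r → (h zero + r) + c)
    (trans (Σℕ.sum-cong-≗ (λ s → h≡c (suc s) λ ())) (sumℕ-const n c)) ⟩
  (h zero + n * c) + c          ≡⟨ ℕ.+-assoc (h zero) (n * c) c ⟩
  h zero + (n * c + c)          ≡⟨ ℕ.+-comm (h zero) _ ⟩
  (n * c + c) + h zero          ≡⟨ cong (ℕ._+ h zero) (ℕ.+-comm (n * c) c) ⟩
  (c + n * c) + h zero          ∎
  where open ≡-Reasoning
sum-one-exception {suc n} (suc x) h c h≡c = begin
  (h zero + Σℕ.sum (h ∘ suc)) + c ≡⟨ ℕ.+-assoc (h zero) _ c ⟩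
  h zero + (Σℕ.sum (h ∘ suc) + c) ≡⟨ cong₂ ℕ._+_ (h≡c zero λ ())
    (sum-one-exception x (h ∘ suc) c (λ s s≢x → h≡c (suc s) (s≢x ∘ Fin.suc-injective))) ⟩
  c + (n * c + h (suc x))       ≡⟨ ℕ.+-assoc c (n * c) _ ⟨
  (c + n * c) + h (suc x)       ∎
  where open ≡-Reasoning

count : ∀ {n} → (Fin n → Bool) → ℕ
count P = Σℕ.sum (λ i → if P i then 1 else 0)

count≤n : ∀ {n} (P : Fin n → Bool) → count P ≤ n
count≤n {zero}  P = ℕ.z≤n
count≤n {suc n} P with P zero
... | true  = ℕ.s≤s (count≤n (P ∘ suc))
... | false = ℕ.m≤n⇒m≤1+n (count≤n (P ∘ suc))

count≡n⇒all : ∀ {n} (P : Fin n → Bool) → count P ≡ n → ∀ i → P i ≡ true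
count≡n⇒all {suc n} P eq i with P zero in P₀
... | false = contradiction eq (ℕ.<⇒≢ (ℕ.s≤s (count≤n (P ∘ suc))))
count≡n⇒all {suc n} P eq zero    | true = P₀
count≡n⇒all {suc n} P eq (suc i) | true = count≡n⇒all (P ∘ suc) (ℕ.suc-injective eq) i

-- A bijection of `Fin c` with the support of `P`. Applied to the points of E on a line, it supplies
-- the values of the graph functions there.
record Enumeration {n} (P : Fin n → Bool) (c : ℕ) : Set where
  field
    element   : Fin c → Fin n
    sound     : ∀ i → P (element i) ≡ true
    complete  : ∀ j → P j ≡ true → ∃ λ i → element i ≡ j
    injective : ∀ i i′ → element i ≡ element i′ → i ≡ i′

enumerate : ∀ {n} (P : Fin n → Bool) → Enumeration P (count P)
enumerate {zero} P = record
  { element = λ () ; sound = λ () ; complete = λ () ; injective = λ () }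
enumerate {suc n} P with P zero in P₀ | enumerate (P ∘ suc)
... | false | rest = record
  { element   = suc ∘ element
  ; sound     = sound
  ; complete  = λ { zero P₀′ → contradiction (trans (sym P₀) P₀′) λ ()
                  ; (suc j) Pj → let i , eq = complete j Pj in i , cong suc eq }
  ; injective = λ i i′ → injective i i′ ∘ Fin.suc-injective
  }
  where open Enumeration rest
... | true | rest = record
  { element   = λ { zero → zero ; (suc i) → suc (element i) }
  ; sound     = λ { zero → P₀ ; (suc i) → sound i }
  ; complete  = λ { zero _ → zero , refl
                  ; (suc j) Pj → let i , eq = complete j Pj in suc i , cong suc eq }
  ; injective = λ { zero zero _ → refl
                  ; (suc i) (suc i′) eq → cong suc (injective i i′ (Fin.suc-injective eq)) }
  }
  where open Enumeration rest

-- Lines in F_p²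

module _ {p : ℕ} .{{_ : NonZero p}} where

  sumV : (V {p} → ℕ) → ℕ
  sumV g = Σℕ.sum (λ i → Σℕ.sum (λ j → g (i , j)))

  sum-points : ∀ g → sumList (map g points) ≡ sumV g
  sum-points g = sumList-cartesianProduct g (λ i → i) (λ j → j)

  -- The tiling identity is summed over the p points of first coordinate `t`; what remains is the
  -- convolution of the line counts.
  tiling-projection : ∀ (A E : V {p} → ℕ) k →
    (∀ x → sumV (λ a → A a * E (x -V a)) ≡ k) →
    ∀ t → Σℕ.sum (λ t′ → Σℕ.sum (λ s → A (t′ , s)) * Σℕ.sum (λ s → E (t -F t′ , s))) ≡ p * k
  tiling-projection A E k tiles t = begin
    Σℕ.sum (λ t′ → Σℕ.sum (λ s′ → A (t′ , s′)) * e t′)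
      ≡⟨ Σℕ.sum-cong-≗ (λ t′ → Σℕ.*-distribʳ-sum (e t′) (λ s′ → A (t′ , s′))) ⟩
    Σℕ.sum (λ t′ → Σℕ.sum (λ s′ → A (t′ , s′) * e t′))
      -- A sum over a whole line is unchanged by a shift; shifting by `s′` makes the argument of `E`
      -- a difference of vectors.
      ≡⟨ Σℕ.sum-cong-≗ (λ t′ → Σℕ.sum-cong-≗ (λ s′ → trans
           (cong (A (t′ , s′) *_) (Σℕ.sum-permute (λ s → E (t -F t′ , s)) (translation⁻¹ s′)))
           (Σℕ.*-distribˡ-sum (A (t′ , s′)) (λ s → E (t -F t′ , s -F s′))))) ⟩
    Σℕ.sum (λ t′ → Σℕ.sum (λ s′ → Σℕ.sum (λ s → A (t′ , s′) * E (t -F t′ , s -F s′))))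
      ≡⟨ Σℕ.sum-cong-≗ (λ t′ → Σℕ.∑-comm (λ s′ s → A (t′ , s′) * E (t -F t′ , s -F s′))) ⟩
    Σℕ.sum (λ t′ → Σℕ.sum (λ s → Σℕ.sum (λ s′ → A (t′ , s′) * E (t -F t′ , s -F s′))))
      ≡⟨ Σℕ.∑-comm (λ t′ s → Σℕ.sum (λ s′ → A (t′ , s′) * E (t -F t′ , s -F s′))) ⟩
    Σℕ.sum (λ s → sumV (λ a → A a * E ((t , s) -V a)))
      ≡⟨ Σℕ.sum-cong-≗ (λ s → tiles (t , s)) ⟩
    Σℕ.sum {p} (λ _ → k)
      ≡⟨ sumℕ-const p k ⟩
    p * k ∎
    where
    open ≡-Reasoning
    e : F p → ℕ
    e t′ = Σℕ.sum (λ s → E (t -F t′ , s))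

  -- Frames and counts on parallel lines

  module _ (e₁ e₂ : V {p}) where

    point : V {p} → V {p}
    point (t , s) = (t · e₁) +V (s · e₂)

    point--V : ∀ v w → point v -V point w ≡ point (v -V w)
    point--V (t , s) (t′ , s′) = cong₂ _,_ (component (proj₁ e₁) (proj₁ e₂)) (component (proj₂ e₁) (proj₂ e₂))
      where
      component : ∀ a b → ((t *F a) +F (s *F b)) -F ((t′ *F a) +F (s′ *F b))
                          ≡ ((t -F t′) *F a) +F ((s -F s′) *F b)
      component a b = trans (+F--F-interchange (t *F a) (s *F b) (t′ *F a) (s′ *F b))
        (sym (cong₂ _+F_ (*F-distribʳ--F a t t′) (*F-distribʳ--F b s s′)))

    point-0V : point 0V ≡ 0V
    point-0V = cong₂ _,_ (component (proj₁ e₁) (proj₁ e₂)) (component (proj₂ e₁) (proj₂ e₂))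
      where
      component : ∀ a b → (0F *F a) +F (0F *F b) ≡ 0F
      component a b = trans (cong₂ _+F_ (*F-zeroˡ a) (*F-zeroˡ b)) (+F-identityʳ 0F)

    -- The lines have direction `e₂` and are indexed by their coefficient of `e₁`.
    lineCount : (V {p} → Bool) → F p → ℕ
    lineCount E t = count (λ s → E (point (t , s)))

    Equidistributed : (V {p} → Bool) → Set
    Equidistributed E = ∀ t → lineCount E t ≡ lineCount E 0F

    -- The inverse coordinates and the invariance of sums are kept as data, since they are explicit
    -- for the frames used below; no general theory of bases is required.
    record Frame : Set where
      field
        coords       : V {p} → V {p}
        point-coords : ∀ v → point (coords v) ≡ v
        coords-point : ∀ v → coords (point v) ≡ v
        sum-point    : ∀ g → sumV (g ∘ point) ≡ sumV g

    module _ (frame : Frame) where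
      open Frame frame

      point-injective : ∀ {v w} → point v ≡ point w → v ≡ w
      point-injective {v} {w} eq = trans (sym (coords-point v)) (trans (cong coords eq) (coords-point w))

      frame-isBasis : IsBasis e₁ e₂
      frame-isBasis a b eq = cong proj₁ ab≡0 , cong proj₂ ab≡0
        where
        ab≡0 : (a , b) ≡ 0V
        ab≡0 = point-injective (trans eq (sym point-0V))

      sum-lineCount : ∀ E → Σℕ.sum (lineCount E) ≡ card E
      sum-lineCount E = trans (sum-point (ind E)) (sym (sum-points (ind E)))

      equidistributed⇒card : ∀ E → Equidistributed E → card E ≡ lineCount E 0F * p
      equidistributed⇒card E const = begin
        card E                               ≡⟨ sum-lineCount E ⟨
        Σℕ.sum (lineCount E)                 ≡⟨ Σℕ.sum-cong-≗ const ⟩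
        Σℕ.sum {p} (λ _ → lineCount E 0F)    ≡⟨ sumℕ-const p (lineCount E 0F) ⟩
        p * lineCount E 0F                 ≡⟨ ℕ.*-comm p _ ⟩
        lineCount E 0F * p                 ∎
        where open ≡-Reasoning

      -- `f i x` is the i-th point of E on the line indexed by `x`; equal counts let one index set
      -- serve all lines. A common point of two graphs has the same `x` in both, and injectivity of
      -- the enumeration then identifies the graphs.
      lines-disjoint-union : ∀ E s → (∀ t → lineCount E t ≡ s) →
        Σ (Fin s → F p → F p) λ f →
          (∀ v → (E v ≡ true) ⇔ (∃ λ i → ∃ λ x → v ≡ (x · e₁) +V (f i x · e₂)))
          × (∀ i j x y → i ≢ j → (x · e₁) +V (f i x · e₂) ≢ (y · e₁) +V (f j y · e₂))
      lines-disjoint-union E s const = f , (λ v → mk⇔ (⇒ v) (⇐ v)) , disjoint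
        where
        line : ∀ t → Enumeration (λ s → E (point (t , s))) s
        line t = subst (Enumeration _) (const t) (enumerate (λ s → E (point (t , s))))
        f : Fin s → F p → F p
        f i x = Enumeration.element (line x) i
        ⇒ : ∀ v → E v ≡ true → ∃ λ i → ∃ λ x → v ≡ point (x , f i x)
        ⇒ v Ev =
          let x , y = coords v
              i , fix≡y = Enumeration.complete (line x) y (trans (cong E (point-coords v)) Ev)
          in i , x , trans (sym (point-coords v)) (cong (λ z → point (x , z)) (sym fix≡y))
        ⇐ : ∀ v → (∃ λ i → ∃ λ x → v ≡ point (x , f i x)) → E v ≡ true
        ⇐ v (i , x , v≡) = trans (cong E v≡) (Enumeration.sound (line x) i)
        disjoint : ∀ i j x y → i ≢ j → point (x , f i x) ≢ point (y , f j y)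
        disjoint i j x y i≢j eq = i≢j (Enumeration.injective (line x) i j (trans (cong proj₂ xf≡yf)
          (cong (f j) (sym (cong proj₁ xf≡yf)))))
          where
          xf≡yf : (x , f i x) ≡ (y , f j y)
          xf≡yf = point-injective eq

      module _ {k : ℕ} (E A : V {p} → Bool) (tiles : KTiles E k A) where

        -- As `point` respects subtraction and preserves sums over the plane, the tiling pulls back
        -- to frame coordinates, where it can be projected.
        lineCount-⋆ : ∀ t → Σℕ.sum (λ t′ → lineCount A t′ * lineCount E (t -F t′)) ≡ p * k
        lineCount-⋆ = tiling-projection (ind A ∘ point) (ind E ∘ point) k tiles-point
          where
          open ≡-Reasoning
          tiles-point : ∀ x → sumV (λ a → ind A (point a) * ind E (point (x -V a))) ≡ k
          tiles-point x = begin
            sumV (λ a → ind A (point a) * ind E (point (x -V a)))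
              ≡⟨ Σℕ.sum-cong-≗ (λ i → Σℕ.sum-cong-≗ (λ j →
                   cong (λ v → ind A (point (i , j)) * ind E v) (point--V x (i , j)))) ⟨
            sumV (λ a → ind A (point a) * ind E (point x -V point a))
              ≡⟨ sum-point (λ a → ind A a * ind E (point x -V a)) ⟩
            sumV (λ a → ind A a * ind E (point x -V a))
              ≡⟨ sum-points (λ a → ind A a * ind E (point x -V a)) ⟨
            sumList (map (λ a → ind A a * ind E (point x -V a)) points)
              ≡⟨ tiles (point x) ⟩
            k ∎

        A-equidistributed⇒card : Equidistributed A → lineCount A 0F * card E ≡ p * k
        A-equidistributed⇒card const = begin
          lineCount A 0F * card E
            ≡⟨ cong (lineCount A 0F *_) (sum-lineCount E) ⟨
          lineCount A 0F * Σℕ.sum (lineCount E)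
            -- The reflection puts the sum into the shape of the convolution at `0F`.
            ≡⟨ cong (lineCount A 0F *_) (Σℕ.sum-permute (lineCount E) (reflection 0F)) ⟩
          lineCount A 0F * Σℕ.sum (λ t′ → lineCount E (0F -F t′))
            ≡⟨ Σℕ.*-distribˡ-sum (lineCount A 0F) (λ t′ → lineCount E (0F -F t′)) ⟩
          Σℕ.sum (λ t′ → lineCount A 0F * lineCount E (0F -F t′))
            ≡⟨ Σℕ.sum-cong-≗ (λ t′ → cong (_* lineCount E (0F -F t′)) (const t′)) ⟨
          Σℕ.sum (λ t′ → lineCount A t′ * lineCount E (0F -F t′))
            ≡⟨ lineCount-⋆ 0F ⟩
          p * k ∎
          where open ≡-Reasoning

        E-equidistributed⇒card : Equidistributed E → card A * lineCount E 0F ≡ p * k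
        E-equidistributed⇒card const = begin
          card A * lineCount E 0F
            ≡⟨ cong (_* lineCount E 0F) (sum-lineCount A) ⟨
          Σℕ.sum (lineCount A) * lineCount E 0F
            ≡⟨ Σℕ.*-distribʳ-sum (lineCount E 0F) (lineCount A) ⟩
          Σℕ.sum (λ t′ → lineCount A t′ * lineCount E 0F)
            ≡⟨ Σℕ.sum-cong-≗ (λ t′ → cong (lineCount A t′ *_) (const (0F -F t′))) ⟨
          Σℕ.sum (λ t′ → lineCount A t′ * lineCount E (0F -F t′))
            ≡⟨ lineCount-⋆ 0F ⟩
          p * k ∎
          where open ≡-Reasoning

        equidistributed-E⊎A : Prime p → Equidistributed E ⊎ Equidistributed A
        equidistributed-E⊎A pp = Sum.swap (Sum.map (λ c t → ℤ.+-injective (c t)) (λ c t → ℤ.+-injective (c t))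
          (⋆-constant⇒constant pp a e λ t → trans (a⋆e t) (sym (a⋆e 0F))))
          where
          a e : F p → ℤ
          a t = + lineCount A t
          e t = + lineCount E t
          a⋆e : ∀ t → (a ⋆ e) t ≡ + (p * k)
          a⋆e t = trans (trans
            (Σℤ.sum-cong-≗ (λ t′ → sym (ℤ.pos-* (lineCount A t′) (lineCount E (t -F t′)))))
            (sym (pos-sum (λ t′ → lineCount A t′ * lineCount E (t -F t′))))) (cong +_ (lineCount-⋆ t))

  -- The p + 1 directions

  e₁∞ e₂∞ : V {p}
  e₁∞ = 1F , 0F
  e₂∞ = 0F , 1F

  point-∞ : ∀ v → point e₁∞ e₂∞ v ≡ v
  point-∞ (t , s) = cong₂ _,_
    (trans (cong₂ _+F_ (*F-identityʳ t) (*F-zeroʳ s)) (+F-identityʳ t))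
    (trans (cong₂ _+F_ (*F-zeroʳ t) (*F-identityʳ s)) (+F-identityˡ s))

  frame-∞ : Frame e₁∞ e₂∞
  frame-∞ = record
    { coords       = λ v → v
    ; point-coords = point-∞
    ; coords-point = point-∞
    ; sum-point    = λ g → Σℕ.sum-cong-≗ (λ i → Σℕ.sum-cong-≗ (λ j → cong g (point-∞ (i , j))))
    }

  -- With the vertical vector first, the index `t` of a line of slope m is its intercept: the line
  -- is y = t + m x, parametrized by its abscissa.
  e₁-slope : V {p}
  e₁-slope = 0F , 1F

  e₂-slope : F p → V {p}
  e₂-slope m = 1F , m

  point-slope : ∀ m t s → point e₁-slope (e₂-slope m) (t , s) ≡ (s , t +F (s *F m))
  point-slope m t s = cong₂ _,_
    (trans (cong₂ _+F_ (*F-zeroʳ t) (*F-identityʳ s)) (+F-identityˡ s))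
    (cong (_+F (s *F m)) (*F-identityʳ t))

  frame-slope : ∀ m → Frame e₁-slope (e₂-slope m)
  frame-slope m = record
    { coords       = coords
    ; point-coords = λ (x , y) → trans (point-slope m (y -F (x *F m)) x) (cong (x ,_) (-F-+F y (x *F m)))
    ; coords-point = λ (t , s) → trans (cong coords (point-slope m t s)) (cong (_, s) (+F--F t (s *F m)))
    ; sum-point    = λ g → begin
        sumV (g ∘ point e₁-slope (e₂-slope m))
          ≡⟨ Σℕ.sum-cong-≗ (λ t → Σℕ.sum-cong-≗ (λ s → cong g (point-slope m t s))) ⟩
        Σℕ.sum (λ t → Σℕ.sum (λ s → g (s , t +F (s *F m))))
          ≡⟨ Σℕ.∑-comm (λ t s → g (s , t +F (s *F m))) ⟩
        Σℕ.sum (λ s → Σℕ.sum (λ t → g (s , t +F (s *F m))))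
          -- On each vertical line the shear is a translation.
          ≡⟨ Σℕ.sum-cong-≗ (λ s → Σℕ.sum-permute (λ t → g (s , t)) (translation (s *F m))) ⟨
        sumV g ∎
    }
    where
    open ≡-Reasoning
    coords : V {p} → V {p}
    coords (x , y) = y -F (x *F m) , x

  -- Summing over the p non-vertical lines through (x , y): each has c points, while every vertical
  -- line other than that of abscissa x is met exactly once in each of its points.
  constant-in-all-directions : Prime p → ∀ (A : V {p} → Bool) c →
    (∀ t → lineCount e₁∞ e₂∞ A t ≡ c) → (∀ m t → lineCount e₁-slope (e₂-slope m) A t ≡ c) →
    ∀ v → c ≡ p * ind A v
  constant-in-all-directions pp A c vertical slopes v@(x , y) =
    ℕ.+-cancelˡ-≡ (p * c) c (p * ind A v) (begin
      p * c + c              ≡⟨ cong (ℕ._+ c) Σh≡pc ⟨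
      Σℕ.sum h + c             ≡⟨ sum-one-exception x h c h-off ⟩
      p * c + h x            ≡⟨ cong (p * c ℕ.+_) h-on ⟩
      p * c + p * ind A v  ∎)
    where
    open ≡-Reasoning
    h : F p → ℕ
    h s = Σℕ.sum (λ m → ind A (s , (y -F (x *F m)) +F (s *F m)))
    Σh≡pc : Σℕ.sum h ≡ p * c
    Σh≡pc = begin
      Σℕ.sum h
        ≡⟨ Σℕ.∑-comm (λ s m → ind A (s , (y -F (x *F m)) +F (s *F m))) ⟩
      Σℕ.sum (λ m → Σℕ.sum (λ s → ind A (s , (y -F (x *F m)) +F (s *F m))))
        ≡⟨ Σℕ.sum-cong-≗ (λ m → trans
             (Σℕ.sum-cong-≗ (λ s → cong (ind A) (sym (point-slope m (y -F (x *F m)) s))))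
             (slopes m (y -F (x *F m)))) ⟩
      Σℕ.sum {p} (λ _ → c)
        ≡⟨ sumℕ-const p c ⟩
      p * c ∎
    h-on : h x ≡ p * ind A v
    h-on = trans (Σℕ.sum-cong-≗ (λ m → cong (λ z → ind A (x , z)) (-F-+F y (x *F m)))) (sumℕ-const p (ind A v))
    regroup : ∀ s m → (y -F (x *F m)) +F (s *F m) ≡ ((s -F x) *F m) +F y
    regroup s m = begin
      (y -F (x *F m)) +F (s *F m)  ≡⟨ +F--F-comm y (s *F m) (x *F m) ⟨
      (y +F (s *F m)) -F (x *F m)  ≡⟨ cong (_-F (x *F m)) (+F-comm y (s *F m)) ⟩
      ((s *F m) +F y) -F (x *F m)  ≡⟨ +F--F-comm (s *F m) y (x *F m) ⟩
      ((s *F m) -F (x *F m)) +F y  ≡⟨ cong (_+F y) (*F-distribʳ--F m s x) ⟨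
      ((s -F x) *F m) +F y         ∎
    -- For s different from x the element `s -F x` is invertible, so the ordinate
    -- `((s -F x) *F m) +F y` runs once through F_p as the slope m does.
    h-off : ∀ s → s ≢ x → h s ≡ c
    h-off s s≢x =
      let w , w[s-x]≡1 = *F-inverse pp (s -F x) λ s-x≡0 →
            s≢x (trans (sym (-F-+F s x)) (trans (cong (_+F x) s-x≡0) (+F-identityˡ x)))
      in begin
      h s
        ≡⟨ Σℕ.sum-cong-≗ (λ m → cong (λ z → ind A (s , z)) (regroup s m)) ⟩
      Σℕ.sum (λ m → ind A (s , ((s -F x) *F m) +F y))
        ≡⟨ Σℕ.sum-permute (λ z → ind A (s , z +F y)) (scaling (s -F x) w w[s-x]≡1) ⟨
      Σℕ.sum (λ z → ind A (s , z +F y))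
        ≡⟨ Σℕ.sum-permute (λ z → ind A (s , z)) (translation y) ⟨
      Σℕ.sum (λ z → ind A (s , z))
        ≡⟨ Σℕ.sum-cong-≗ (λ z → cong (ind A) (point-∞ (s , z))) ⟨
      lineCount e₁∞ e₂∞ A s
        ≡⟨ vertical s ⟩
      c ∎

  -- The three alternatives

  module _ (pp : Prime p) {k : ℕ} (1≤k : 1 ≤ k) (E A : V {p} → Bool) (tiles : KTiles E k A) where

    pk≢0 : p * k ≢ 0
    pk≢0 = [ ℕ.≢-nonZero⁻¹ p , (λ k≡0 → ℕ.<⇒≢ 1≤k (sym k≡0)) ]′ ∘ ℕ.m*n≡0⇒m≡0∨n≡0 p

    Graphs : Set
    Graphs = Σ ℕ λ s → 1 ≤ s × s ≤ p ∸ 1 × s ∣ k × card E ≡ s * p ×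
      Σ (V {p}) λ e₁ → Σ (V {p}) λ e₂ → IsBasis e₁ e₂ ×
      Σ (Fin s → F p → F p) λ f →
        (∀ v → (E v ≡ true) ⇔ (∃ λ i → ∃ λ x → v ≡ (x · e₁) +V (f i x · e₂)))
        × (∀ i j x y → i ≢ j → (x · e₁) +V (f i x · e₂) ≢ (y · e₁) +V (f j y · e₂))

    E-equidistributed⇒full⊎graphs : ∀ e₁ e₂ → Frame e₁ e₂ →
      Equidistributed e₁ e₂ E →
      ((∀ v → E v ≡ true) × card A ≡ k) ⊎ Graphs
    E-equidistributed⇒full⊎graphs e₁ e₂ frame const =
      [ (λ s<p → inj₂ (graphs s<p)) , (λ s≡p → inj₁ (full s≡p)) ]′
        -- A line has p points, so its count is at most p; equality means that E contains every
        -- line.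
        (ℕ.m≤n⇒m<n∨m≡n (count≤n (λ y → E (point e₁ e₂ (0F , y)))))
      where
      open Frame frame
      s : ℕ
      s = lineCount e₁ e₂ E 0F
      |A|s≡pk : card A * s ≡ p * k
      |A|s≡pk = E-equidistributed⇒card e₁ e₂ frame E A tiles const
      full : s ≡ p → (∀ v → E v ≡ true) × card A ≡ k
      full s≡p = (λ v → trans (cong E (sym (point-coords v)))
                    (count≡n⇒all _ (trans (const (proj₁ (coords v))) s≡p) (proj₂ (coords v))))
               , ℕ.*-cancelˡ-≡ (card A) k p (trans (ℕ.*-comm p (card A))
                   (trans (cong (card A *_) (sym s≡p)) |A|s≡pk))
      s≢0 : s ≢ 0
      s≢0 s≡0 = pk≢0 (trans (sym |A|s≡pk) (trans (cong (card A *_) s≡0) (ℕ.*-zeroʳ (card A))))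
      graphs : s < p → Graphs
      graphs s<p =
        s , ℕ.n≢0⇒n>0 s≢0 , ℕ.<⇒≤pred s<p
        -- Since 0 < s < p, s is coprime to p and its divisibility into `p * k` passes to `k`.
        , Coprimality.coprime-divisor
            (Coprimality.sym (Coprimality.prime⇒coprime pp {{ℕ.≢-nonZero s≢0}} s<p))
            (ℕ.divides (card A) (sym |A|s≡pk))
        , equidistributed⇒card e₁ e₂ frame E const
        , e₁ , e₂ , frame-isBasis e₁ e₂ frame
        , lines-disjoint-union e₁ e₂ frame E s const

    -- The common line count c equals p times the indicator of A at every point. As `c * card E` is
    -- the nonzero number `p * k`, c is nonzero, so every indicator is 1; then c is p, and
    -- cancelling p leaves the size of E.
    A-equidistributed⇒full : Equidistributed e₁∞ e₂∞ A →
      (∀ m → Equidistributed e₁-slope (e₂-slope m) A) →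
      card E ≡ k × (∀ v → A v ≡ true)
    A-equidistributed⇒full vertical slopes = |E|≡k , A-full
      where
      c : ℕ
      c = lineCount e₁∞ e₂∞ A 0F
      c|E|≡pk : c * card E ≡ p * k
      c|E|≡pk = A-equidistributed⇒card e₁∞ e₂∞ frame-∞ E A tiles vertical
      -- In each direction p times the line count is the size of A, so the counts agree across
      -- directions.
      same-count : ∀ m → lineCount e₁-slope (e₂-slope m) A 0F ≡ c
      same-count m = ℕ.*-cancelʳ-≡ _ _ p (trans
        (sym (equidistributed⇒card e₁-slope (e₂-slope m) (frame-slope m) A (slopes m)))
        (equidistributed⇒card e₁∞ e₂∞ frame-∞ A vertical))
      c≡pA : ∀ v → c ≡ p * ind A v
      c≡pA = constant-in-all-directions pp A c vertical (λ m t → trans (slopes m t) (same-count m))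
      c≢0 : c ≢ 0
      c≢0 c≡0 = pk≢0 (trans (sym c|E|≡pk) (cong (_* card E) c≡0))
      A-full : ∀ v → A v ≡ true
      A-full v = ¬false⇒true (A v) λ Av≡false → c≢0 (trans (c≡pA v)
        (trans (cong (λ b → p * (if b then 1 else 0)) Av≡false) (ℕ.*-zeroʳ p)))
        where
        ¬false⇒true : ∀ b → b ≢ false → b ≡ true
        ¬false⇒true true  _       = refl
        ¬false⇒true false b≢false = contradiction refl b≢false
      c≡p : c ≡ p
      c≡p = trans (c≡pA 0V) (trans (cong (λ b → p * (if b then 1 else 0)) (A-full 0V)) (ℕ.*-identityʳ p))
      |E|≡k : card E ≡ k
      |E|≡k = ℕ.*-cancelˡ-≡ (card E) k p (trans (cong (_* card E) (sym c≡p)) c|E|≡pk)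

    trichotomy : (card E ≡ k × (∀ v → A v ≡ true)) ⊎ ((∀ v → E v ≡ true) × card A ≡ k) ⊎ Graphs
    -- A slope in which E is equidistributed can be searched for, there being finitely many. If none
    -- exists, the dichotomy yields A in every slope.
    trichotomy = decide (equidistributed-E⊎A e₁∞ e₂∞ frame-∞ E A tiles pp) (Fin.any? λ m →
        Fin.all? λ t → lineCount e₁-slope (e₂-slope m) E t ≟ lineCount e₁-slope (e₂-slope m) E 0F)
      where
      decide : Equidistributed e₁∞ e₂∞ E ⊎ Equidistributed e₁∞ e₂∞ A →
               Dec (∃ λ m → Equidistributed e₁-slope (e₂-slope m) E) →
               (card E ≡ k × (∀ v → A v ≡ true)) ⊎ ((∀ v → E v ≡ true) × card A ≡ k) ⊎ Graphs
      decide (inj₁ const) _ = inj₂ (E-equidistributed⇒full⊎graphs e₁∞ e₂∞ frame-∞ const)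
      decide (inj₂ _) (yes (m , const)) =
        inj₂ (E-equidistributed⇒full⊎graphs e₁-slope (e₂-slope m) (frame-slope m) const)
      decide (inj₂ vertical) (no none) = inj₁ (A-equidistributed⇒full vertical λ m →
        [ (λ const → contradiction (m , const) none) , (λ const → const) ]′
          (equidistributed-E⊎A e₁-slope (e₂-slope m) (frame-slope m) E A tiles pp))

mainTheorem3 : (p : ℕ) .{{_ : NonZero p}} → Prime p →
  (k : ℕ) → 1 ≤ k → (E A : V {p} → Bool) → KTiles E k A →
    (card E ≡ k × (∀ v → A v ≡ true))
    ⊎ ((∀ v → E v ≡ true) × card A ≡ k)
    ⊎ (Σ ℕ λ s → 1 ≤ s × s ≤ p ∸ 1 × s ∣ k × card E ≡ s * p ×
        Σ (V {p}) λ e₁ → Σ (V {p}) λ e₂ → IsBasis e₁ e₂ ×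
        Σ (Fin s → F p → F p) λ f →
          (∀ v → (E v ≡ true) ⇔ (∃ λ i → ∃ λ x → v ≡ (x · e₁) +V (f i x · e₂)))
          × (∀ i j x y → i ≢ j → (x · e₁) +V (f i x · e₂) ≢ (y · e₁) +V (f j y · e₂)))
mainTheorem3 p pp k 1≤k E A tiles = trichotomy pp 1≤k E A tiles
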